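{- Let $\gamma \ge 1$ be an integer and let $G$ be a graph with maximum degree $\Delta$ that contains no copy of $K_{2,\gamma+1}$ (as a subgraph) in which the two vertices of the part of size $2$ are non-adjacent in $G$. Then $\chi_a(G) \le \left\lceil \left(1+\sqrt{2\gamma+4}\right)\Delta \right\rceil$.
   Context: An acyclic coloring of a graph is a proper vertex-coloring in which no cycle is bicolored (equivalently, the subgraph induced by any two color classes is a forest). $\chi_a(G)$ is the minimum number of colors in an acyclic coloring of $G$. $K_{2,\gamma+1}$ is the complete bipartite graph with parts of sizes $2$ and $\gamma+1$.
   Formalization: The formal statement additionally assumes Δ ≥ 1; for Δ = 0 the claim fails, since an edgeless graph with at least one vertex has acyclic chromatic number 1 while the bound is 0. -}

module Defs where

open import Data.Empty using (⊥)
open import Data.Fin using (Fin; zero; suc; inject₁; fromℕ; finToFun; funToFin)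
open import Data.Fin.Properties using (any?; all?; injective⇒≤; finToFun-funToFin)
  renaming (_≟_ to _≟ᶠ_)
open import Data.List using (allFin; filter; foldr; length; map)
open import Data.Nat using (ℕ; zero; suc; _+_; _*_; _^_; _≤_; _<_; _⊔_; _≤?_; z≤n; s≤s)
open import Data.Nat.Properties using (anyUpTo?; m≤n+m; ≤-trans; m≤m*n)
open import Data.Product using (∃; ∃₂; _×_; _,_; proj₁; proj₂)
open import Data.Sum using (_⊎_; inj₁; inj₂)
open import Data.Unit using (⊤; tt)
open import Function using (id; _∘_)
open import Function.Definitions using (Injective)
open import Level using (0ℓ)
open import Relation.Binary using (Rel; Symmetric; Irreflexive)
  renaming (Decidable to Decidable₂)
open import Relation.Binary.PropositionalEquality
  using (_≡_; _≢_; _≗_; refl; sym; trans; subst; subst₂)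
open import Relation.Nullary using (Dec; yes; no; ¬_; ¬?; contradiction)
open import Relation.Nullary.Decidable using (map′; _×-dec_; _⊎-dec_; _→-dec_)
open import Relation.Unary using (Pred; Decidable)

IsLeast : Pred ℕ 0ℓ → ℕ → Set
IsLeast P k = P k × (∀ {j} → P j → k ≤ j)

least : {P : Pred ℕ 0ℓ} → Decidable P → ∀ n → P n → ∃ (IsLeast P)
least P? n pn with P? 0
... | yes p0 = 0 , p0 , λ _ → z≤n
least P? zero    pn | no ¬p0 = contradiction pn ¬p0
least {P} P? (suc n) pn | no ¬p0 with least {P ∘ suc} (P? ∘ suc) n pn
... | k , pk , k-least = suc k , pk , minimal
  where
  minimal : ∀ {j} → P j → suc k ≤ j
  minimal {zero}  p0 = contradiction p0 ¬p0
  minimal {suc j} pj = s≤s (k-least pj)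

n≤n*n : ∀ n → n ≤ n * n
n≤n*n zero    = z≤n
n≤n*n (suc n) = m≤m*n (suc n) (suc n)

⌈√⌉-least : ∀ n → ∃ (IsLeast (λ m → n ≤ m * m))
⌈√⌉-least n = least (λ m → n ≤? m * m) n (n≤n*n n)

⌈√_⌉ : ℕ → ℕ
⌈√ n ⌉ = proj₁ (⌈√⌉-least n)

-- ⌈(1 + √ d) D⌉.  For a natural number D one has (1 + √ d) D = D + √ (d D²),
-- and the integer summand D can be taken out of the ceiling.
⌈[1+√_]*_⌉ : ℕ → ℕ → ℕ
⌈[1+√ d ]* D ⌉ = D + ⌈√ d * D ^ 2 ⌉

record Graph (V : Set) : Set₁ where
  infix 4 _∼_ _∼?_
  field
    _∼_      : Rel V 0ℓ
    ∼-sym    : Symmetric _∼_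
    ∼-irrefl : Irreflexive _≡_ _∼_
    _∼?_     : Decidable₂ _∼_

degree : ∀ {n} → Graph (Fin n) → Fin n → ℕ
degree {n} G v = length (filter (v ∼?_) (allFin n))
  where open Graph G

maxDegree : ∀ {n} → Graph (Fin n) → ℕ
maxDegree {n} G = foldr _⊔_ 0 (map (degree G) (allFin n))

-- A copy of H in G as a not necessarily induced subgraph.
record Copy {U V : Set} (H : Graph U) (G : Graph V) : Set where
  private
    module H = Graph H
    module G = Graph G
  field
    vertex    : U → V
    injective : Injective _≡_ _≡_ vertex
    edge      : ∀ {x y} → x H.∼ y → vertex x G.∼ vertex y

K : ∀ a b → Graph (Fin a ⊎ Fin b)
K a b = record
  { _∼_      = Adj
  ; ∼-sym    = λ {x} {y} → Adj-sym x y
  ; ∼-irrefl = λ {x} → λ { refl → Adj-irrefl x }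
  ; _∼?_     = Adj?
  }
  where
  Adj : Rel (Fin a ⊎ Fin b) 0ℓ
  Adj (inj₁ _) (inj₁ _) = ⊥
  Adj (inj₁ _) (inj₂ _) = ⊤
  Adj (inj₂ _) (inj₁ _) = ⊤
  Adj (inj₂ _) (inj₂ _) = ⊥

  Adj-sym : ∀ x y → Adj x y → Adj y x
  Adj-sym (inj₁ _) (inj₂ _) _ = tt
  Adj-sym (inj₂ _) (inj₁ _) _ = tt

  Adj-irrefl : ∀ x → ¬ Adj x x
  Adj-irrefl (inj₁ _) ()
  Adj-irrefl (inj₂ _) ()

  Adj? : Decidable₂ Adj
  Adj? (inj₁ _) (inj₁ _) = no λ ()
  Adj? (inj₁ _) (inj₂ _) = yes tt
  Adj? (inj₂ _) (inj₁ _) = yes tt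
  Adj? (inj₂ _) (inj₂ _) = no λ ()

-- The part of size 2 is the first one.  If b ≡ 2 as well, quantifying over all
-- copies lets either side of a 4-cycle play that role.
NonAdjacentPair : ∀ {V b} (G : Graph V) → Copy (K 2 b) G → Set
NonAdjacentPair G c = ¬ (vertex (inj₁ zero) ∼ vertex (inj₁ (suc zero)))
  where
  open Graph G
  open Copy c

module _ {V : Set} (G : Graph V) where
  open Graph G

  -- c lists the vertices of a cycle of length 3 + m in cyclic order.
  record IsCycle {m} (c : Fin (3 + m) → V) : Set where
    field
      injective : Injective _≡_ _≡_ c
      step      : ∀ i → c (inject₁ i) ∼ c (suc i)
      close     : c (fromℕ (2 + m)) ∼ c zero

  IsProper : ∀ {k} → (V → Fin k) → Set
  IsProper f = ∀ {x y} → x ∼ y → f x ≢ f y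

  Bicoloured : ∀ {k m} → (V → Fin k) → (Fin (3 + m) → V) → Set
  Bicoloured f c = ∃₂ λ a b → ∀ i → f (c i) ≡ a ⊎ f (c i) ≡ b

  record IsAcyclicColouring {k} (f : V → Fin k) : Set where
    field
      proper  : IsProper f
      acyclic : ∀ {m} (c : Fin (3 + m) → V) → IsCycle c → ¬ Bicoloured f c

  AcyclicallyColourable : ℕ → Set
  AcyclicallyColourable k = ∃ λ (f : V → Fin k) → IsAcyclicColouring f

anyFun? : ∀ {m n} {P : Pred (Fin m → Fin n) 0ℓ} →
          (∀ {f g} → f ≗ g → P f → P g) → Decidable P → Dec (∃ P)
anyFun? resp P? = map′
  (λ (i , p) → finToFun i , p)
  (λ (f , p) → funToFin f , resp (sym ∘ finToFun-funToFin f) p)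
  (any? (P? ∘ finToFun))

module _ {n} (G : Graph (Fin n)) where
  open Graph G

  isCycle-resp : ∀ {m} {c d : Fin (3 + m) → Fin n} →
                 c ≗ d → IsCycle G c → IsCycle G d
  isCycle-resp {m} {c} {d} c≗d cyc = record
    { injective = λ {i} {j} eq → injective (trans (c≗d i) (trans eq (sym (c≗d j))))
    ; step      = λ i → subst₂ _∼_ (c≗d (inject₁ i)) (c≗d (suc i)) (step i)
    ; close     = subst₂ _∼_ (c≗d (fromℕ (2 + m))) (c≗d zero) close
    }
    where open IsCycle cyc

  isCycle? : ∀ {m} → Decidable (IsCycle G {m})
  isCycle? {m} c = map′
    (λ (inj , st , cl) → record { injective = λ {i} {j} → inj i j ; step = st ; close = cl })
    (λ cyc → let open IsCycle cyc in (λ i j → injective {i} {j}) , step , close)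
    (      all? (λ i → all? (λ j → (c i ≟ᶠ c j) →-dec (i ≟ᶠ j)))
     ×-dec all? (λ i → c (inject₁ i) ∼? c (suc i))
     ×-dec (c (fromℕ (2 + m)) ∼? c zero))

  bicoloured? : ∀ {k m} (f : Fin n → Fin k) → Decidable (Bicoloured G {k} {m} f)
  bicoloured? f c =
    any? λ a → any? λ b → all? λ i → (f (c i) ≟ᶠ a) ⊎-dec (f (c i) ≟ᶠ b)

  BicolouredCycle : ∀ {k} → (Fin n → Fin k) → ℕ → Set
  BicolouredCycle f m = ∃ λ (c : Fin (3 + m) → Fin n) → IsCycle G c × Bicoloured G f c

  bicolouredCycle? : ∀ {k} (f : Fin n → Fin k) → Decidable (BicolouredCycle f)
  bicolouredCycle? f m = anyFun? resp (λ c → isCycle? c ×-dec bicoloured? f c)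
    where
    resp : ∀ {c d} → c ≗ d → IsCycle G c × Bicoloured G f c →
           IsCycle G d × Bicoloured G f d
    resp c≗d (cyc , a , b , ab) = isCycle-resp c≗d cyc , a , b ,
      λ i → subst (λ v → f v ≡ a ⊎ f v ≡ b) (c≗d i) (ab i)

  cycle-short : ∀ {m} {c : Fin (3 + m) → Fin n} → IsCycle G c → m < n
  cycle-short {m} cyc =
    ≤-trans (s≤s (m≤n+m m 2)) (injective⇒≤ (IsCycle.injective cyc))

  isAcyclicColouring? : ∀ {k} → Decidable (IsAcyclicColouring G {k})
  isAcyclicColouring? f = map′
    (λ (pr , ac) → record
      { proper  = λ {x} {y} → pr x y
      ; acyclic = λ {m} c cyc bi → ac (m , cycle-short cyc , c , cyc , bi)
      })
    (λ col → let open IsAcyclicColouring col in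
      (λ x y → proper {x} {y}) , λ (m , _ , c , cyc , bi) → acyclic c cyc bi)
    (      all? (λ x → all? (λ y → (x ∼? y) →-dec ¬? (f x ≟ᶠ f y)))
     ×-dec ¬? (anyUpTo? (bicolouredCycle? f) n))

  isAcyclicColouring-resp : ∀ {k} {f g : Fin n → Fin k} →
    f ≗ g → IsAcyclicColouring G f → IsAcyclicColouring G g
  isAcyclicColouring-resp f≗g col = record
    { proper  = λ {x} {y} x∼y eq →
        proper x∼y (trans (f≗g x) (trans eq (sym (f≗g y))))
    ; acyclic = λ c cyc (a , b , ab) → acyclic c cyc
        (a , b , λ i → subst (λ z → z ≡ a ⊎ z ≡ b) (sym (f≗g (c i))) (ab i))
    }
    where open IsAcyclicColouring col

  id-acyclic : IsAcyclicColouring G id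
  id-acyclic = record
    { proper  = λ x∼y x≡y → ∼-irrefl x≡y x∼y
    ; acyclic = λ c cyc (a , b , ab) →
        two-values (IsCycle.injective cyc) (ab zero) (ab (suc zero)) (ab (suc (suc zero)))
    }
    where
    two-values : ∀ {m a b} {c : Fin (3 + m) → Fin n} → Injective _≡_ _≡_ c →
      c zero ≡ a ⊎ c zero ≡ b → c (suc zero) ≡ a ⊎ c (suc zero) ≡ b →
      c (suc (suc zero)) ≡ a ⊎ c (suc (suc zero)) ≡ b → ⊥
    two-values inj (inj₁ p) (inj₁ q) _        with () ← inj (trans p (sym q))
    two-values inj (inj₂ p) (inj₂ q) _        with () ← inj (trans p (sym q))
    two-values inj (inj₁ p) (inj₂ q) (inj₁ r) with () ← inj (trans p (sym r))
    two-values inj (inj₁ p) (inj₂ q) (inj₂ r) with () ← inj (trans q (sym r))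
    two-values inj (inj₂ p) (inj₁ q) (inj₁ r) with () ← inj (trans q (sym r))
    two-values inj (inj₂ p) (inj₁ q) (inj₂ r) with () ← inj (trans p (sym r))

  acyclicallyColourable? : Decidable (AcyclicallyColourable G)
  acyclicallyColourable? k = anyFun? isAcyclicColouring-resp isAcyclicColouring?

  χₐ-least : ∃ (IsLeast (AcyclicallyColourable G))
  χₐ-least = least acyclicallyColourable? n (id , id-acyclic)

  χₐ : ℕ
  χₐ = proj₁ χₐ-least

{-# OPTIONS --safe #-}
module Submission where

open import Defs
open import Algebra.Properties.CommutativeSemigroup using (interchange)
open import Data.Fin using (Fin; zero; suc; inject₁; fromℕ; fromℕ<; inject≤) renaming (_≟_ to _≟ᶠ_)
open import Data.Fin.Properties using (inject≤-injective) renaming (any? to anyᶠ?)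
open import Data.List using
  (List; []; _∷_; [_]; _++_; map; length; reverse; filter; allFin; concatMap; tabulate; downFrom;
   foldr; cartesianProductWith)
import Data.List as List
import Data.List.Membership.DecPropositional as DecMembership
open import Data.List.Membership.Propositional using (_∈_; _∉_; find; lose)
open import Data.List.Membership.Propositional.Properties
open import Data.List.Properties using
  (length-tabulate; map-++; map-∘; length-++; length-map; unfold-reverse; ∷-injectiveˡ;
   length-filter; filter-notAll; length-reverse)
open import Data.List.Relation.Binary.Permutation.Propositional
  using (_↭_; ↭-refl; ↭-prep; ↭-sym; ↭-trans; ↭⇒↭ₛ)
open import Data.List.Relation.Binary.Permutation.Propositional.Properties
  using (shift; ++-comm; ↭-reverse; ∈-resp-↭; ↭-length; All-resp-↭)
open import Data.List.Relation.Binary.Permutation.Setoid.Properties using (Unique-resp-↭)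
open import Data.List.Relation.Binary.Subset.Propositional using (_⊆_)
open import Data.List.Relation.Unary.All using (All; []; _∷_)
import Data.List.Relation.Unary.All as All
import Data.List.Relation.Unary.All.Properties as All
open import Data.List.Relation.Unary.AllPairs using ([]; _∷_)
open import Data.List.Relation.Unary.Any using (Any; here; there; any?)
import Data.List.Relation.Unary.Any as Any
import Data.List.Relation.Unary.Unique.DecPropositional as DecUnique
open import Data.List.Relation.Unary.Unique.Propositional using (Unique)
import Data.List.Relation.Unary.Unique.Propositional.Properties as Unique
open import Data.Nat using
  (ℕ; zero; suc; _+_; _*_; _^_; _⊔_; _≤_; _<_; _≤?_; _≟_; z≤n; s≤s; NonZero; >-nonZero; >-nonZero⁻¹)
open import Data.Nat.ListAction using (sum)
open import Data.Nat.ListAction.Properties using (sum-++)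
open import Data.Nat.Properties hiding (_≟_; _≤?_)
open import Data.Nat.Tactic.RingSolver using (solve-∀)
open import Data.Product using (∃; _×_; _,_; proj₁; proj₂)
open import Data.Sum using (_⊎_; inj₁; inj₂)
open import Data.Unit using (⊤; tt)
open import Data.Vec using (Vec; []; _∷_; lookup; _[_]≔_; replicate)
open import Data.Vec.Properties using (lookup∘updateAt; lookup∘updateAt′)
open import Function using (_∘_; id; case_of_)
open import Level using (0ℓ)
open import Relation.Binary using (Rel; Symmetric)
open import Relation.Binary.PropositionalEquality
  using (_≡_; _≢_; refl; sym; trans; cong; cong₂; subst; setoid; module ≡-Reasoning)
open import Relation.Nullary using (Dec; yes; no; ¬_; ¬?; contradiction)
open import Relation.Nullary.Decidable using (_×-dec_; _⊎-dec_)
open import Relation.Unary using (Pred; Decidable)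

-- Put m = ⌈√((2γ+4)Δ²)⌉ and k = Δ + m, and let N(S) be the number of maps f from all vertices
-- to k colours that restrict to an acyclic colouring of G[S].  We show m N(S) ≤ 2k N(S ∪ v) for
-- v ∉ S by induction on |S|; hence N(V) > 0.  A map counted in N(S) but not in N(S ∪ v) either
-- gives v the colour of a neighbour, which happens for at most (Δ/k) N(S) maps, or creates a
-- bicoloured cycle through v.  If the cycle has length 2j+4, all but two of its vertices have
-- their colours forced by the others; removing the forced vertices other than v from S and
-- applying the induction hypothesis 2j+1 times, one sees that at most (2/m)^(2j+1) N(S)/k maps
-- make this cycle bicoloured.  The vertex two steps from v along the cycle has the colour of v,
-- so it is not adjacent to v and shares at most γ neighbours with it; thus at most γ Δ^(2j+2)
-- closed walks need to be considered, and each bad map is met twice because a cycle can be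
-- traversed in both directions.  As m² ≥ (2γ+4)Δ², summing the geometric series over j leaves at
-- most m N(S)/2k bad maps of the second kind.

-- Finite sums of natural numbers and indicators of decidable propositions.

private variable
  A B P Q R : Set

∑ : List A → (A → ℕ) → ℕ
∑ xs h = sum (map h xs)

syntax ∑ xs (λ x → e) = ∑[ x ← xs ] e

infixr 8 ∑

⟦_⟧ : Dec P → ℕ
⟦ yes _ ⟧ = 1
⟦ no  _ ⟧ = 0

⟦⟧-mono : (p : Dec P) (q : Dec Q) → (P → Q) → ⟦ p ⟧ ≤ ⟦ q ⟧
⟦⟧-mono (no _)  q       f = z≤n
⟦⟧-mono (yes a) (yes _) f = s≤s z≤n
⟦⟧-mono (yes a) (no ¬b) f = contradiction (f a) ¬b

⟦⟧-mono-* : (p : Dec P) (q : Dec Q) (r : Dec R) → (P → Q × R) → ⟦ p ⟧ ≤ ⟦ q ⟧ * ⟦ r ⟧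
⟦⟧-mono-* (no _)  q       r       f = z≤n
⟦⟧-mono-* (yes a) (yes _) (yes _) f = s≤s z≤n
⟦⟧-mono-* (yes a) (no ¬b) r       f = let b , _ = f a in contradiction b ¬b
⟦⟧-mono-* (yes a) (yes _) (no ¬c) f = let _ , c = f a in contradiction c ¬c

⟦⟧≥1 : (p : Dec P) → P → 1 ≤ ⟦ p ⟧
⟦⟧≥1 (yes _) _ = s≤s z≤n
⟦⟧≥1 (no ¬a) a = contradiction a ¬a

⟦⟧≡0 : (p : Dec P) → ¬ P → ⟦ p ⟧ ≡ 0
⟦⟧≡0 (yes a) ¬a = contradiction a ¬a
⟦⟧≡0 (no _)  _  = refl

⟦⟧>0 : (p : Dec P) → 0 < ⟦ p ⟧ → P
⟦⟧>0 (yes a) _ = a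

∑-mono : ∀ {g h : A → ℕ} xs → (∀ x → g x ≤ h x) → ∑ xs g ≤ ∑ xs h
∑-mono []       le = z≤n
∑-mono (x ∷ xs) le = +-mono-≤ (le x) (∑-mono xs le)

∑-cong : ∀ {g h : A → ℕ} xs → (∀ x → g x ≡ h x) → ∑ xs g ≡ ∑ xs h
∑-cong []       eq = refl
∑-cong (x ∷ xs) eq = cong₂ _+_ (eq x) (∑-cong xs eq)

∑-0 : ∀ (xs : List A) → ∑[ x ← xs ] 0 ≡ 0
∑-0 []       = refl
∑-0 (x ∷ xs) = ∑-0 xs

∑-+ : ∀ (g h : A → ℕ) xs → ∑[ x ← xs ] (g x + h x) ≡ ∑ xs g + ∑ xs h
∑-+ g h []       = refl
∑-+ g h (x ∷ xs) = begin
  g x + h x + ∑[ y ← xs ] (g y + h y)  ≡⟨ cong (g x + h x +_) (∑-+ g h xs) ⟩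
  g x + h x + (∑ xs g + ∑ xs h)        ≡⟨ interchange +-commutativeSemigroup (g x) (h x) _ _ ⟩
  g x + ∑ xs g + (h x + ∑ xs h)        ∎
  where open ≡-Reasoning

∑-*ˡ : ∀ c (h : A → ℕ) xs → ∑[ x ← xs ] (c * h x) ≡ c * ∑ xs h
∑-*ˡ c h []       = sym (*-zeroʳ c)
∑-*ˡ c h (x ∷ xs) = begin
  c * h x + ∑[ y ← xs ] (c * h y)  ≡⟨ cong (c * h x +_) (∑-*ˡ c h xs) ⟩
  c * h x + c * ∑ xs h             ≡⟨ *-distribˡ-+ c (h x) _ ⟨
  c * (h x + ∑ xs h)               ∎
  where open ≡-Reasoning

∑-swap : ∀ (h : A → B → ℕ) xs ys →
         ∑[ x ← xs ] ∑[ y ← ys ] h x y ≡ ∑[ y ← ys ] ∑[ x ← xs ] h x y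
∑-swap h []       ys = sym (∑-0 ys)
∑-swap h (x ∷ xs) ys = begin
  ∑ ys (h x) + ∑[ x ← xs ] ∑[ y ← ys ] h x y  ≡⟨ cong (∑ ys (h x) +_) (∑-swap h xs ys) ⟩
  ∑ ys (h x) + ∑[ y ← ys ] ∑[ x ← xs ] h x y  ≡⟨ ∑-+ (h x) _ ys ⟨
  ∑[ y ← ys ] (h x y + ∑[ x ← xs ] h x y)     ∎
  where open ≡-Reasoning

∑-const : ∀ c (xs : List A) → ∑[ x ← xs ] c ≡ length xs * c
∑-const c []       = refl
∑-const c (x ∷ xs) = cong (c +_) (∑-const c xs)

*-∑-bound : ∀ c {b} {h : A → ℕ} xs → (∀ {x} → x ∈ xs → c * h x ≤ b) → c * ∑ xs h ≤ length xs * b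
*-∑-bound c         []       le = ≤-reflexive (*-zeroʳ c)
*-∑-bound c {b} {h} (x ∷ xs) le = begin
  c * (h x + ∑ xs h)       ≡⟨ *-distribˡ-+ c (h x) _ ⟩
  c * h x + c * ∑ xs h     ≤⟨ +-mono-≤ (le (here refl)) (*-∑-bound c xs (le ∘ there)) ⟩
  b + length xs * b        ∎
  where open ≤-Reasoning

∑-≥-term : ∀ (h : A → ℕ) {x xs} → x ∈ xs → h x ≤ ∑ xs h
∑-≥-term h (here refl) = m≤m+n _ _
∑-≥-term h (there x∈)  = m≤n⇒m≤o+n _ (∑-≥-term h x∈)

∑-≥-two-terms : ∀ (h : A → ℕ) {x y xs} → x ∈ xs → y ∈ xs → x ≢ y → h x + h y ≤ ∑ xs h
∑-≥-two-terms h (here refl) (here refl) x≢y = contradiction refl x≢y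
∑-≥-two-terms h (here refl) (there y∈)  x≢y = +-monoʳ-≤ _ (∑-≥-term h y∈)
∑-≥-two-terms h {x} {y} {_ ∷ xs} (there x∈) (here refl) x≢y = begin
  h x + h y     ≤⟨ +-monoˡ-≤ (h y) (∑-≥-term h x∈) ⟩
  ∑ xs h + h y  ≡⟨ +-comm _ (h y) ⟩
  h y + ∑ xs h  ∎
  where open ≤-Reasoning
∑-≥-two-terms h (there x∈)  (there y∈)  x≢y = m≤n⇒m≤o+n _ (∑-≥-two-terms h x∈ y∈ x≢y)

∑>0 : ∀ (h : A → ℕ) xs → 0 < ∑ xs h → ∃ λ x → 0 < h x
∑>0 h (x ∷ xs) pos with h x in eq
... | zero  = ∑>0 h xs pos
... | suc _ = x , subst (0 <_) (sym eq) (s≤s z≤n)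

∑-++ : ∀ (h : A → ℕ) xs ys → ∑ (xs ++ ys) h ≡ ∑ xs h + ∑ ys h
∑-++ h xs ys = trans (cong sum (map-++ h xs ys)) (sum-++ (map h xs) (map h ys))

∑-map : ∀ (h : B → ℕ) (g : A → B) xs → ∑ (map g xs) h ≡ ∑ xs (h ∘ g)
∑-map h g xs = cong sum (sym (map-∘ xs))

∑-cartesianProductWith : ∀ {C : Set} (h : C → ℕ) (g : A → B → C) xs ys →
  ∑ (cartesianProductWith g xs ys) h ≡ ∑[ x ← xs ] ∑[ y ← ys ] h (g x y)
∑-cartesianProductWith h g []       ys = refl
∑-cartesianProductWith h g (x ∷ xs) ys =
  trans (∑-++ h (map (g x) ys) _)
        (cong₂ _+_ (∑-map h (g x) ys) (∑-cartesianProductWith h g xs ys))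

-- Enumerating colourings and resampling the colour of one vertex.

module _ {k : ℕ} where

  ∑-indicator≤1 : ∀ (c : Fin k) {xs} → Unique xs → ∑[ x ← xs ] ⟦ x ≟ᶠ c ⟧ ≤ 1
  ∑-indicator≤1 c []                         = z≤n
  ∑-indicator≤1 c (_∷_ {x} {xs} x∉xs unique) with x ≟ᶠ c
  ... | no  _    = ∑-indicator≤1 c unique
  ... | yes refl = ≤-reflexive (cong suc (absent x∉xs))
    where
    absent : ∀ {ys} → All (c ≢_) ys → ∑[ y ← ys ] ⟦ y ≟ᶠ c ⟧ ≡ 0
    absent []                    = refl
    absent {y ∷ _} (c≢y ∷ rest) = cong₂ _+_ (⟦⟧≡0 (y ≟ᶠ c) (c≢y ∘ sym)) (absent rest)

  vectors : ∀ n → List (Vec (Fin k) n)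
  vectors zero    = [ [] ]
  vectors (suc n) = cartesianProductWith _∷_ (allFin k) (vectors n)

  -- Overwriting the entry at `x` is `k`-to-one: a vector `g` arises as `f [ x ]≔ a` only with `a`
  -- its own entry at `x`, while `f` may have any of the `k` entries there.
  ∑-resample : ∀ {n} (x : Fin n) (h : Vec (Fin k) n → ℕ) →
    k * ∑ (vectors n) h ≡ ∑[ f ← vectors n ] ∑[ a ← allFin k ] h (f [ x ]≔ a)
  ∑-resample {suc n} zero h = begin
    k * ∑ (vectors (suc n)) h
      ≡⟨ cong (k *_) (∑-cartesianProductWith h _∷_ (allFin k) (vectors n)) ⟩
    k * (∑[ a ← allFin k ] ∑[ f ← vectors n ] h (a ∷ f))
      ≡⟨ cong (k *_) (∑-swap (λ a f → h (a ∷ f)) (allFin k) (vectors n)) ⟩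
    k * s
      ≡⟨ cong (_* s) (length-tabulate {n = k} id) ⟨
    length (allFin k) * s
      ≡⟨ ∑-const s (allFin k) ⟨
    ∑[ b ← allFin k ] s
      ≡⟨ ∑-cartesianProductWith _ _∷_ (allFin k) (vectors n) ⟨
    ∑[ f ← vectors (suc n) ] ∑[ a ← allFin k ] h (f [ zero ]≔ a) ∎
    where
    open ≡-Reasoning
    s = ∑[ f ← vectors n ] ∑[ a ← allFin k ] h (a ∷ f)
  ∑-resample {suc n} (suc x) h = begin
    k * ∑ (vectors (suc n)) h
      ≡⟨ cong (k *_) (∑-cartesianProductWith h _∷_ (allFin k) (vectors n)) ⟩
    k * (∑[ b ← allFin k ] ∑[ f ← vectors n ] h (b ∷ f))
      ≡⟨ ∑-*ˡ k _ (allFin k) ⟨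
    ∑[ b ← allFin k ] (k * (∑[ f ← vectors n ] h (b ∷ f)))
      ≡⟨ ∑-cong (allFin k) (λ b → ∑-resample x (h ∘ (b ∷_))) ⟩
    ∑[ b ← allFin k ] ∑[ f ← vectors n ] ∑[ a ← allFin k ] h (b ∷ (f [ x ]≔ a))
      ≡⟨ ∑-cartesianProductWith _ _∷_ (allFin k) (vectors n) ⟨
    ∑[ f ← vectors (suc n) ] ∑[ a ← allFin k ] h (f [ suc x ]≔ a) ∎
    where open ≡-Reasoning

  -- After `x` is resampled, only one of the `k` colours agrees with that of `y`, which the
  -- resampling leaves alone. The hypothesis `indep` frees `P` from the new colour, so the two
  -- conditions decouple into a product.
  count-equal : ∀ {n} {P : Pred (Vec (Fin k) n) 0ℓ} (P? : Decidable P) {x y : Fin n} → x ≢ y →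
    (∀ {f a} → P (f [ x ]≔ a) → P f) →
    k * (∑[ f ← vectors n ] ⟦ P? f ×-dec (lookup f x ≟ᶠ lookup f y) ⟧) ≤
    ∑[ f ← vectors n ] ⟦ P? f ⟧
  count-equal {n} {P} P? {x} {y} x≢y indep = begin
    k * (∑[ f ← vectors n ] ⟦ P? f ×-dec (lookup f x ≟ᶠ lookup f y) ⟧)
      ≡⟨ ∑-resample x _ ⟩
    ∑[ f ← vectors n ] ∑[ a ← allFin k ]
      ⟦ P? (f [ x ]≔ a) ×-dec (lookup (f [ x ]≔ a) x ≟ᶠ lookup (f [ x ]≔ a) y) ⟧
      ≤⟨ ∑-mono (vectors n) (λ f → ∑-mono (allFin k) (λ a →
           ⟦⟧-mono-* _ (P? f) (a ≟ᶠ lookup f y) (λ (p , eq) → indep {f} {a} p ,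
             trans (sym (lookup∘updateAt x f))
               (trans eq (lookup∘updateAt′ y x (x≢y ∘ sym) f))))) ⟩
    ∑[ f ← vectors n ] ∑[ a ← allFin k ] (⟦ P? f ⟧ * ⟦ a ≟ᶠ lookup f y ⟧)
      ≤⟨ ∑-mono (vectors n) (λ f → begin
           ∑[ a ← allFin k ] (⟦ P? f ⟧ * ⟦ a ≟ᶠ lookup f y ⟧)
             ≡⟨ ∑-*ˡ ⟦ P? f ⟧ _ (allFin k) ⟩
           ⟦ P? f ⟧ * (∑[ a ← allFin k ] ⟦ a ≟ᶠ lookup f y ⟧)
             ≤⟨ *-monoʳ-≤ ⟦ P? f ⟧ (∑-indicator≤1 (lookup f y) (Unique.allFin⁺ k)) ⟩
           ⟦ P? f ⟧ * 1
             ≡⟨ *-identityʳ _ ⟩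
           ⟦ P? f ⟧ ∎) ⟩
    ∑[ f ← vectors n ] ⟦ P? f ⟧ ∎
    where open ≤-Reasoning

-- For positive `c` and `q`, the hypothesis reads t(j) ≤ (e/c)(p/q)^j N. Since e ≤ q - p, the first
-- n terms sum to at most (q/c)(1 - (p/q)^n) N. Denominators are cleared, and the subtracted power
-- stands on the left, where it carries the induction.
geometric-∑ : ∀ c {e p q} N (t : ℕ → ℕ) → p + e ≤ q →
  (∀ j → c * (q ^ j * t j) ≤ e * (p ^ j * N)) →
  ∀ n → c * (q ^ n * ∑ (downFrom n) t) + q * (p ^ n * N) ≤ q * (q ^ n * N)
geometric-∑ c {q = q} N t p+e≤q t≤ zero    = ≤-reflexive (base c q N)
  where
  base : ∀ c q N → c * (1 * 0) + q * (1 * N) ≡ q * (1 * N)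
  base = solve-∀
geometric-∑ c {e} {p} {q} N t p+e≤q t≤ (suc n) = begin
  c * (q * q ^ n * (t n + T)) + q * (p * p ^ n * N)
    ≡⟨ regroup c q (q ^ n) (t n) T p (p ^ n) N ⟩
  q * (c * (q ^ n * T) + (c * (q ^ n * t n) + p * (p ^ n * N)))
    ≤⟨ *-monoʳ-≤ q (+-monoʳ-≤ (c * (q ^ n * T)) (+-monoˡ-≤ _ (t≤ n))) ⟩
  q * (c * (q ^ n * T) + (e * (p ^ n * N) + p * (p ^ n * N)))
    ≡⟨ cong (λ s → q * (c * (q ^ n * T) + s)) (collect e p (p ^ n * N)) ⟩
  q * (c * (q ^ n * T) + (p + e) * (p ^ n * N))
    ≤⟨ *-monoʳ-≤ q (+-monoʳ-≤ (c * (q ^ n * T)) (*-monoˡ-≤ _ p+e≤q)) ⟩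
  q * (c * (q ^ n * T) + q * (p ^ n * N))
    ≤⟨ *-monoʳ-≤ q (geometric-∑ c N t p+e≤q t≤ n) ⟩
  q * (q * (q ^ n * N))
    ≡⟨ cong (q *_) (*-assoc q (q ^ n) N) ⟨
  q * (q * q ^ n * N) ∎
  where
  open ≤-Reasoning
  T = ∑ (downFrom n) t
  regroup : ∀ c q Q t T p P N → c * (q * Q * (t + T)) + q * (p * P * N) ≡
                                q * (c * (Q * T) + (c * (Q * t) + p * (P * N)))
  regroup = solve-∀
  collect : ∀ e p X → e * X + p * X ≡ (p + e) * X
  collect = solve-∀

-- Lengths, repetition-free lists and reversal.

length-concatMap-≤ : ∀ {A B : Set} {b} (g : A → List B) xs →
  (∀ x → length (g x) ≤ b) → length (concatMap g xs) ≤ length xs * b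
length-concatMap-≤ g []       le = z≤n
length-concatMap-≤ g (x ∷ xs) le = begin
  length (g x ++ concatMap g xs)          ≡⟨ length-++ (g x) ⟩
  length (g x) + length (concatMap g xs)  ≤⟨ +-mono-≤ (le x) (length-concatMap-≤ g xs le) ⟩
  _                                       ∎
  where open ≤-Reasoning

Unique-lookup-injective : ∀ {A : Set} {xs : List A} → Unique xs →
  ∀ {i j} → List.lookup xs i ≡ List.lookup xs j → i ≡ j
Unique-lookup-injective (_ ∷ _)      {zero}  {zero}  eq = refl
Unique-lookup-injective (x∉ ∷ _)     {zero}  {suc j} eq = contradiction eq (All.lookup x∉ (∈-lookup j))
Unique-lookup-injective (x∉ ∷ _)     {suc i} {zero}  eq = contradiction (sym eq) (All.lookup x∉ (∈-lookup i))
Unique-lookup-injective (_ ∷ unique) {suc i} {suc j} eq = cong suc (Unique-lookup-injective unique eq)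

-- Keeps the two directions of a cycle apart. The reversal starts with an entry of the tail, and no
-- such entry equals the head.
reverse-≢ : ∀ {A : Set} {w : List A} → Unique w → 2 ≤ length w → reverse w ≢ w
reverse-≢ {w = x ∷ y ∷ w} (x∉ ∷ _) _ eq = head-moved (trans (sym (unfold-reverse x (y ∷ w))) eq)
  (λ x∈ → contradiction refl (All.lookup x∉ (∈-resp-↭ (↭-reverse (y ∷ w)) x∈)))
  where
  head-moved : ∀ {s t} → s ++ [ x ] ≡ x ∷ y ∷ t → ¬ ¬ (x ∈ s)
  head-moved {z ∷ s} eq x∉s = x∉s (here (sym (∷-injectiveˡ eq)))
reverse-≢ {w = []}    _ ()
reverse-≢ {w = _ ∷ []} _ (s≤s ())

-- Walks as lists of inner vertices.

module _ {V : Set} (R : Rel V 0ℓ) where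

  -- w lists the inner vertices of a walk from x to z.
  Chain : V → List V → V → Set
  Chain x []      z = R x z
  Chain x (y ∷ w) z = R x y × Chain y w z

module _ {V : Set} {R : Rel V 0ℓ} where

  chain-++ : ∀ {x y z w′} w → Chain R x w y → Chain R y w′ z → Chain R x (w ++ y ∷ w′) z
  chain-++ []      r       d = r , d
  chain-++ (_ ∷ w) (r , c) d = r , chain-++ w c d

  chain-split : ∀ {x y z w′} w → Chain R x (w ++ y ∷ w′) z → Chain R x w y × Chain R y w′ z
  chain-split []      (r , d) = r , d
  chain-split (_ ∷ w) (r , c) = let c₁ , c₂ = chain-split w c in (r , c₁) , c₂

  chain-reverse : Symmetric R → ∀ {x z} w → Chain R x w z → Chain R z (reverse w) x
  chain-reverse R-sym []      r       = R-sym r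
  chain-reverse R-sym {x} {z} (y ∷ w) (r , c) = subst (λ u → Chain R z u x) (sym (unfold-reverse y w))
    (chain-++ (reverse w) (chain-reverse R-sym w c) (R-sym r))

  -- Cutting the closed walk at `v` and swapping the two pieces. This brings a newly added vertex to
  -- the front of a cycle through it.
  chain-rotate : ∀ {x w v} → v ∈ x ∷ w → Chain R x w x → ∃ λ w′ → Chain R v w′ v × x ∷ w ↭ v ∷ w′
  chain-rotate {w = w} (here refl) c = w , c , ↭-refl
  chain-rotate {x} {v = v} (there v∈w) c with xs , ys , refl ← ∈-∃++ v∈w =
    let c₁ , c₂ = chain-split xs c in
    ys ++ x ∷ xs , chain-++ ys c₂ c₁ ,
    ↭-trans (shift v (x ∷ xs) ys) (↭-prep v (++-comm (x ∷ xs) ys))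

  chain-tabulate : ∀ {z} m (c : Fin (suc m) → V) → (∀ i → R (c (inject₁ i)) (c (suc i))) →
                   R (c (fromℕ m)) z → Chain R (c zero) (tabulate (c ∘ suc)) z
  chain-tabulate zero    c step close = close
  chain-tabulate (suc m) c step close = step zero , chain-tabulate m (c ∘ suc) (step ∘ suc) close

-- Colour patterns along two-coloured walks.

module _ {V C : Set} (f : V → C) where

  -- Weaker than being bicoloured, but each equation determines the colour of its first vertex
  -- from the colours of later ones.
  SkipEqual : List V → Set
  SkipEqual (x ∷ w@(y ∷ z ∷ _)) = f x ≡ f z × SkipEqual w
  SkipEqual _                   = ⊤

module _ {V : Set} {k} (f : V → Fin k) where

  skipEqual? : Decidable (SkipEqual f)
  skipEqual? []                  = yes tt
  skipEqual? (x ∷ [])            = yes tt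
  skipEqual? (x ∷ y ∷ [])        = yes tt
  skipEqual? (x ∷ w@(y ∷ z ∷ _)) = (f x ≟ᶠ f z) ×-dec skipEqual? w

module _ {V C : Set} (f : V → C) {a b : C} where

  private
    Coloured : V → Set
    Coloured x = f x ≡ a ⊎ f x ≡ b

  alternate : ∀ {x y z} → Coloured x → Coloured y → Coloured z →
              f x ≢ f y → f y ≢ f z → f x ≡ f z
  alternate (inj₁ p) _        (inj₁ r) _   _   = trans p (sym r)
  alternate (inj₂ p) _        (inj₂ r) _   _   = trans p (sym r)
  alternate (inj₁ p) (inj₁ q) (inj₂ r) x≢y _   = contradiction (trans p (sym q)) x≢y
  alternate (inj₁ p) (inj₂ q) (inj₂ r) _   y≢z = contradiction (trans q (sym r)) y≢z
  alternate (inj₂ p) (inj₁ q) (inj₁ r) _   y≢z = contradiction (trans q (sym r)) y≢z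
  alternate (inj₂ p) (inj₂ q) (inj₁ r) x≢y _   = contradiction (trans p (sym q)) x≢y

module _ {V C : Set} {R : Rel V 0ℓ} {f : V → C} (proper : ∀ {x y} → R x y → f x ≢ f y)
         {a b : C} where

  private
    Coloured : V → Set
    Coloured x = f x ≡ a ⊎ f x ≡ b

  skipEqual : ∀ {x z} w → Chain R x w z → All Coloured (x ∷ w) → SkipEqual f (x ∷ w)
  skipEqual []          _             _                      = tt
  skipEqual (y ∷ [])    _             _                      = tt
  skipEqual (y ∷ z ∷ w) (r , r′ , c) (cx ∷ cs@(cy ∷ cz ∷ _)) =
    alternate f cx cy cz (proper r) (proper r′) , skipEqual (z ∷ w) (r′ , c) cs

  -- Every step switches between the two colours, so the ends share a colour exactly when the number
  -- of steps, one more than the number of inner vertices, is even.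
  walk-parity : ∀ {x z} w → Chain R x w z → All Coloured (x ∷ w) → Coloured z →
    (∃ λ j → length w ≡ 1 + 2 * j × f x ≡ f z) ⊎ (∃ λ j → length w ≡ 2 * j × f x ≢ f z)
  walk-parity []      r       _                _  = inj₂ (0 , refl , proper r)
  walk-parity {x} (y ∷ w) (r , c) (cx ∷ cs@(cy ∷ _)) cz with walk-parity w c cs cz
  ... | inj₁ (j , len , y≡z) =
        inj₂ (suc j , trans (cong suc len) (sym (*-suc 2 j)) , λ x≡z → proper r (trans x≡z (sym y≡z)))
  ... | inj₂ (j , len , y≢z) =
        inj₁ (j , cong suc len , alternate f cx cy cz (proper r) y≢z)

  closed-walk-odd : ∀ {x} w → Chain R x w x → All Coloured (x ∷ w) → ∃ λ j → length w ≡ 1 + 2 * j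
  closed-walk-odd w c cs with walk-parity w c cs (All.head cs)
  ... | inj₁ (j , len , _)   = j , len
  ... | inj₂ (_ , _ , x≢x) = contradiction refl x≢x

-- Common neighbours and the number of walks.

module _ {n} (G : Graph (Fin n)) where
  open Graph G

  neighbours : Fin n → List (Fin n)
  neighbours x = filter (x ∼?_) (allFin n)

  commonNeighbours : Fin n → Fin n → List (Fin n)
  commonNeighbours x y = filter (λ z → (x ∼? z) ×-dec (y ∼? z)) (allFin n)

  ∈-neighbours : ∀ {x y} → x ∼ y → y ∈ neighbours x
  ∈-neighbours {x} {y} = ∈-filter⁺ (x ∼?_) (∈-allFin y)

  degree≤maxDegree : ∀ x → length (neighbours x) ≤ maxDegree G
  degree≤maxDegree x = ≤-max (∈-map⁺ (degree G) (∈-allFin x))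
    where
    ≤-max : ∀ {d ds} → d ∈ ds → d ≤ foldr _⊔_ 0 ds
    ≤-max (here refl) = m≤m⊔n _ _
    ≤-max (there d∈)  = m≤n⇒m≤o⊔n _ (≤-max d∈)

  -- With `b = suc γ`, this turns the excluded configuration into a bound of γ on common neighbours.
  -- The two sides of the copy are disjoint because no vertex is adjacent to itself.
  commonNeighbours-copy : ∀ {x y b} → x ≢ y → ¬ (x ∼ y) → b ≤ length (commonNeighbours x y) →
                          ∃ λ (c : Copy (K 2 b) G) → NonAdjacentPair G c
  commonNeighbours-copy {x} {y} {b} x≢y x≁y b≤ = record
    { vertex    = vertex
    ; injective = λ {u} {w} → injective u w
    ; edge      = λ {u} {w} → edge u w
    } , x≁y
    where
    common : ∀ i → x ∼ List.lookup (commonNeighbours x y) i × y ∼ List.lookup (commonNeighbours x y) i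
    common i = All.lookup (All.all-filter (λ z → (x ∼? z) ×-dec (y ∼? z)) (allFin n)) (∈-lookup i)

    vertex : Fin 2 ⊎ Fin b → Fin n
    vertex (inj₁ zero)       = x
    vertex (inj₁ (suc zero)) = y
    vertex (inj₂ i)          = List.lookup (commonNeighbours x y) (inject≤ i b≤)

    edge : ∀ u w → Graph._∼_ (K 2 b) u w → vertex u ∼ vertex w
    edge (inj₁ zero)       (inj₂ i) _ = proj₁ (common _)
    edge (inj₁ (suc zero)) (inj₂ i) _ = proj₂ (common _)
    edge (inj₂ i) (inj₁ zero)       _ = ∼-sym (proj₁ (common _))
    edge (inj₂ i) (inj₁ (suc zero)) _ = ∼-sym (proj₂ (common _))

    injective : ∀ u w → vertex u ≡ vertex w → u ≡ w
    injective (inj₁ zero)       (inj₁ zero)       eq = refl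
    injective (inj₁ zero)       (inj₁ (suc zero)) eq = contradiction eq x≢y
    injective (inj₁ (suc zero)) (inj₁ zero)       eq = contradiction (sym eq) x≢y
    injective (inj₁ (suc zero)) (inj₁ (suc zero)) eq = refl
    injective (inj₁ zero)       (inj₂ i)          eq = contradiction (proj₁ (common _)) (∼-irrefl eq)
    injective (inj₁ (suc zero)) (inj₂ i)          eq = contradiction (proj₂ (common _)) (∼-irrefl eq)
    injective (inj₂ i)          (inj₁ zero)       eq = contradiction (proj₁ (common _)) (∼-irrefl (sym eq))
    injective (inj₂ i)          (inj₁ (suc zero)) eq = contradiction (proj₂ (common _)) (∼-irrefl (sym eq))
    injective (inj₂ i)          (inj₂ j)          eq = cong inj₂ (inject≤-injective _ _ i j
      (Unique-lookup-injective (Unique.filter⁺ (λ z → (x ∼? z) ×-dec (y ∼? z)) (Unique.allFin⁺ n)) eq))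

  module _ (v : Fin n) where

    -- Empty in the cases where the bound on common neighbours does not apply, so that the factor γ
    -- holds throughout. A bicoloured cycle through `v` never meets these cases.
    lastSteps : Fin n → List (Fin n)
    lastSteps x with (x ∼? v) ⊎-dec (x ≟ᶠ v)
    ... | yes _ = []
    ... | no  _ = commonNeighbours x v

    -- The inner vertices of walks of length j + 2 from x to v whose vertex two steps
    -- before the end is neither v nor adjacent to v.
    walks : Fin n → ℕ → List (List (Fin n))
    walks x zero    = map [_] (lastSteps x)
    walks x (suc j) = concatMap (λ y → map (y ∷_) (walks y j)) (neighbours x)

    -- The first `j` inner vertices have at most Δ choices each. The last one is a common neighbour
    -- of two distinct non-adjacent vertices, which leaves at most γ.
    length-walks : ∀ {Δ γ} → (∀ x → length (neighbours x) ≤ Δ) →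
      (∀ {x y} → x ≢ y → ¬ (x ∼ y) → length (commonNeighbours x y) ≤ γ) →
      ∀ x j → length (walks x j) ≤ Δ ^ j * γ
    length-walks {Δ} {γ} deg codeg x zero with (x ∼? v) ⊎-dec (x ≟ᶠ v)
    ... | yes _ = z≤n
    ... | no ¬p = begin
      length (map [_] (commonNeighbours x v)) ≡⟨ length-map [_] (commonNeighbours x v) ⟩
      length (commonNeighbours x v)           ≤⟨ codeg (¬p ∘ inj₂) (¬p ∘ inj₁) ⟩
      γ                                       ≡⟨ *-identityˡ γ ⟨
      1 * γ                                   ∎
      where open ≤-Reasoning
    length-walks {Δ} {γ} deg codeg x (suc j) = begin
      length (walks x (suc j))
        ≤⟨ length-concatMap-≤ _ (neighbours x) (λ y →
             ≤-trans (≤-reflexive (length-map (y ∷_) (walks y j))) (length-walks deg codeg y j)) ⟩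
      length (neighbours x) * (Δ ^ j * γ)  ≤⟨ *-monoˡ-≤ (Δ ^ j * γ) (deg x) ⟩
      Δ * (Δ ^ j * γ)                      ≡⟨ *-assoc Δ (Δ ^ j) γ ⟨
      Δ * Δ ^ j * γ                        ∎
      where open ≤-Reasoning

    walks-step : ∀ {x y w j} → x ∼ y → w ∈ walks y j → y ∷ w ∈ walks x (suc j)
    walks-step x∼y w∈ = ∈-concatMap⁺ _ (lose (∈-neighbours x∼y) (∈-map⁺ _ w∈))

    module _ {k} {R : Rel (Fin n) 0ℓ} {f : Fin n → Fin k} (adjacent : ∀ {x y} → R x y → x ∼ y)
             (proper : ∀ {x y} → R x y → f x ≢ f y) {a b : Fin k}
             (rainbow : ∀ {x} → f x ≡ f v → ¬ (x ∼ v)) where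

      -- Colours alternate, so the vertex two steps before the end has the colour of `v`. By
      -- `rainbow` it is not adjacent to `v`, and by uniqueness it is not `v` itself; hence
      -- `lastSteps` is not empty by default there.
      ∈-walks : ∀ {x} w j → length w ≡ suc j → Chain R x w v →
        All (λ y → f y ≡ a ⊎ f y ≡ b) (v ∷ x ∷ w) → Unique (v ∷ x ∷ w) → w ∈ walks x j
      ∈-walks {x} (y ∷ []) zero _ (r , r′) (cv ∷ cx ∷ cy ∷ []) ((v≢x ∷ _) ∷ _)
        with (x ∼? v) ⊎-dec (x ≟ᶠ v)
      ... | yes (inj₁ x∼v) = contradiction x∼v (rainbow (alternate f cx cy cv (proper r) (proper r′)))
      ... | yes (inj₂ x≡v) = contradiction (sym x≡v) v≢x
      ... | no  _ = ∈-map⁺ [_] (∈-filter⁺ (λ z → (x ∼? z) ×-dec (v ∼? z)) (∈-allFin y)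
                                  (adjacent r , ∼-sym (adjacent r′)))
      ∈-walks (y ∷ w@(_ ∷ _)) (suc j) len (r , c) (cv ∷ _ ∷ cs) ((_ ∷ v∉) ∷ (_ ∷ unique)) =
        walks-step {j = j} (adjacent r) (∈-walks w j (suc-injective len) c (cv ∷ cs) (v∉ ∷ unique))

-- Membership, permutation and deletion in lists.

∈-vectors : ∀ {k n} (f : Vec (Fin k) n) → f ∈ vectors n
∈-vectors []       = here refl
∈-vectors (a ∷ f)  = ∈-cartesianProductWith⁺ _∷_ (∈-allFin a) (∈-vectors f)

Unique-↭ : ∀ {A : Set} {xs ys : List A} → xs ↭ ys → Unique xs → Unique ys
Unique-↭ p = Unique-resp-↭ (setoid _) (↭⇒↭ₛ p)

module _ {n : ℕ} where
  open DecMembership (_≟ᶠ_ {n}) public using (_∈?_)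
  open DecUnique (_≟ᶠ_ {n}) public using (unique?)

  delete : Fin n → List (Fin n) → List (Fin n)
  delete x = filter (λ y → ¬? (y ≟ᶠ x))

  ∈-delete⁻ : ∀ {x y S} → y ∈ delete x S → y ∈ S × y ≢ x
  ∈-delete⁻ = ∈-filter⁻ (λ y → ¬? (y ≟ᶠ _))

  delete-⊆ : ∀ {x S} → delete x S ⊆ S
  delete-⊆ = proj₁ ∘ ∈-delete⁻

  ∈-delete⁺ : ∀ {x y S} → y ∈ S → y ≢ x → y ∈ delete x S
  ∈-delete⁺ = ∈-filter⁺ (λ y → ¬? (y ≟ᶠ _))

  ∷-delete-⊇ : ∀ {x S} → S ⊆ x ∷ delete x S
  ∷-delete-⊇ {x} {S} {y} y∈ with y ≟ᶠ x
  ... | yes y≡x = here y≡x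
  ... | no  y≢x = there (∈-delete⁺ y∈ y≢x)

  length-delete : ∀ {x S} → x ∈ S → length (delete x S) < length S
  length-delete x∈ = filter-notAll _ _ (Any.map (λ { refl ¬≡ → ¬≡ refl }) x∈)

-- Induced subgraphs and the number of their acyclic colourings.

module _ {n} (G : Graph (Fin n)) where
  open Graph G

  -- The vertices outside S are kept as isolated ones.
  induced : List (Fin n) → Graph (Fin n)
  induced S = record
    { _∼_      = λ x y → x ∼ y × x ∈ S × y ∈ S
    ; ∼-sym    = λ (x∼y , x∈ , y∈) → ∼-sym x∼y , y∈ , x∈
    ; ∼-irrefl = λ x≡y (x∼y , _) → ∼-irrefl x≡y x∼y
    ; _∼?_     = λ x y → (x ∼? y) ×-dec ((x ∈? S) ×-dec (y ∈? S))
    }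

  cycle-⊆ : ∀ {S m} {c : Fin (3 + m) → Fin n} → IsCycle (induced S) c → ∀ i → c i ∈ S
  cycle-⊆ cyc zero    = proj₂ (proj₂ (IsCycle.close cyc))
  cycle-⊆ cyc (suc i) = proj₂ (proj₂ (IsCycle.step cyc i))

  cycle-restrict : ∀ {S T m} {c : Fin (3 + m) → Fin n} → (∀ i → c i ∈ T) →
                   IsCycle (induced S) c → IsCycle (induced T) c
  cycle-restrict ∈T cyc = record
    { injective = injective
    ; step      = λ i → proj₁ (step i) , ∈T _ , ∈T _
    ; close     = proj₁ close , ∈T _ , ∈T _
    }
    where open IsCycle cyc

  module _ {k : ℕ} where

    Good : List (Fin n) → Vec (Fin k) n → Set
    Good S f = IsAcyclicColouring (induced S) (lookup f)

    opaque
      good? : ∀ S → Decidable (Good S)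
      good? S f = isAcyclicColouring? (induced S) (lookup f)

    good-⊆ : ∀ {S T f} → S ⊆ T → Good T f → Good S f
    good-⊆ S⊆T good = record
      { proper  = λ (x∼y , x∈ , y∈) → proper (x∼y , S⊆T x∈ , S⊆T y∈)
      ; acyclic = λ c cyc → acyclic c (cycle-restrict (S⊆T ∘ cycle-⊆ cyc) cyc)
      }
      where open IsAcyclicColouring good

    -- Vertices outside `S` lie on no edge and no cycle of the induced graph, so their colours are
    -- free.
    good-local : ∀ {S f g} → (∀ {x} → x ∈ S → lookup f x ≡ lookup g x) → Good S f → Good S g
    good-local {g = g} eq good = record
      { proper  = λ x∼y@(_ , x∈ , y∈) gx≡gy → proper x∼y (trans (eq x∈) (trans gx≡gy (sym (eq y∈))))
      ; acyclic = λ c cyc (a , b , ab) → acyclic c cyc (a , b , λ i →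
          subst (λ e → e ≡ a ⊎ e ≡ b) (sym (eq (cycle-⊆ cyc i))) (ab i))
      }
      where open IsAcyclicColouring good

    good-resample : ∀ {S x f a} → x ∉ S → Good S (f [ x ]≔ a) → Good S f
    good-resample {S} {x} {f} {a} x∉ = good-local {f = f [ x ]≔ a} {g = f} (λ {y} y∈ →
      lookup∘updateAt′ y x (λ { refl → x∉ y∈ }) f)

    skipEqual-resample : ∀ {x : Fin n} {f : Vec (Fin k) n} {a} w → All (x ≢_) w →
      SkipEqual (lookup (f [ x ]≔ a)) w → SkipEqual (lookup f) w
    skipEqual-resample []          _    _         = _
    skipEqual-resample (_ ∷ [])    _    _         = _
    skipEqual-resample (_ ∷ _ ∷ []) _   _         = _
    skipEqual-resample {x} {f} {a} (u ∷ w@(y ∷ z ∷ _)) (x≢u ∷ x∉@(_ ∷ x≢z ∷ _)) (eq , rest) =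
      trans (sym (lookup∘updateAt′ u x (x≢u ∘ sym) f))
        (trans eq (lookup∘updateAt′ z x (x≢z ∘ sym) f)) ,
      skipEqual-resample {f = f} {a} w x∉ rest

    #good : List (Fin n) → ℕ
    #good S = ∑[ f ← vectors n ] ⟦ good? S f ⟧

    #good-⊆ : ∀ {S T} → S ⊆ T → #good T ≤ #good S
    #good-⊆ {S} {T} S⊆T = ∑-mono (vectors n) (λ f → ⟦⟧-mono (good? T f) (good? S f) (good-⊆ {f = f} S⊆T))

  -- Bicoloured cycles through a newly added vertex.

  closedWalks : Fin n → ℕ → List (List (Fin n))
  closedWalks v j = filter (λ w → (length w ≟ 3 + 2 * j) ×-dec unique? (v ∷ w)) (walks G v v (2 + 2 * j))

  module _ {k} {S : List (Fin n)} {v : Fin n} {f : Vec (Fin k) n} (good : Good S f)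
           (rainbow : ∀ {u} → v ∼ u → lookup f v ≢ lookup f u) where

    private
      module good = IsAcyclicColouring good
      module H = Graph (induced (v ∷ S))

    extend-proper : IsProper (induced (v ∷ S)) (lookup f)
    extend-proper (x∼y , here refl , _)       = rainbow x∼y
    extend-proper (x∼y , there x∈ , here refl) = rainbow (∼-sym x∼y) ∘ sym
    extend-proper (x∼y , there x∈ , there y∈)  = good.proper (x∼y , x∈ , y∈)

    module _ {a b : Fin k} where

      -- A cycle of length 4 + 2j through `v` has 3 + 2j further vertices. The first of them is
      -- split off by a separate step, because `∈-walks` needs a starting point other than the end
      -- `v`.
      ∈-closedWalks : ∀ {j w} → length w ≡ 3 + 2 * j → Chain H._∼_ v w v →
        All (λ x → lookup f x ≡ a ⊎ lookup f x ≡ b) (v ∷ w) → Unique (v ∷ w) → w ∈ closedWalks v j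
      ∈-closedWalks {j} {w@(y ∷ t)} len (r , c) cs unique =
        ∈-filter⁺ _ (walks-step G v {j = 1 + 2 * j} (proj₁ r)
          (∈-walks G v proj₁ extend-proper (λ eq x∼v → rainbow (∼-sym x∼v) (sym eq))
            t (1 + 2 * j) (suc-injective len) c cs unique)) (len , unique)

      -- The cycle read backwards from `v` is a different list that meets the same conditions.
      two-closedWalks : ∀ {j w} (h : List (Fin n) → ℕ) → length w ≡ 3 + 2 * j → Chain H._∼_ v w v →
        All (λ x → lookup f x ≡ a ⊎ lookup f x ≡ b) (v ∷ w) → Unique (v ∷ w) →
        (∀ {w} → SkipEqual (lookup f) (v ∷ w) → 1 ≤ h w) → 2 ≤ ∑ (closedWalks v j) h
      two-closedWalks {j} {w} h len c cs unique@(_ ∷ unique′) h≥1 = begin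
        1 + 1                   ≤⟨ +-mono-≤ (h≥1 (skipEqual extend-proper w c cs))
                                            (h≥1 (skipEqual extend-proper (reverse w) c⁻ cs⁻)) ⟩
        h w + h (reverse w)     ≤⟨ ∑-≥-two-terms h (∈-closedWalks {j} len c cs unique)
                                     (∈-closedWalks {j} (trans (length-reverse w) len) c⁻ cs⁻ (Unique-↭ perm unique))
                                     (reverse-≢ unique′ (subst (2 ≤_) (sym len) (s≤s (s≤s z≤n))) ∘ sym) ⟩
        ∑ (closedWalks v j) h   ∎
        where
        open ≤-Reasoning
        perm : v ∷ w ↭ v ∷ reverse w
        perm = ↭-prep v (↭-sym (↭-reverse w))
        c⁻  = chain-reverse (λ {x} {y} → H.∼-sym {x} {y}) w c
        cs⁻ = All-resp-↭ perm cs

    -- A bicoloured cycle avoiding `v` already lies in the graph on `S`. One through `v` can be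
    -- rotated to start there; it has even length and would contribute at least 2 to the sum. With
    -- `h` abstract, indicators that also record goodness on `S` can be used.
    good-extend : (h : List (Fin n) → ℕ) → (∀ {w} → SkipEqual (lookup f) (v ∷ w) → 1 ≤ h w) →
      ¬ (2 ≤ ∑[ j ← downFrom n ] ∑ (closedWalks v j) h) → Good (v ∷ S) f
    good-extend h h≥1 few = record { proper = extend-proper ; acyclic = acyclic }
      where
      acyclic : ∀ {m} (c : Fin (3 + m) → Fin n) → IsCycle (induced (v ∷ S)) c →
                ¬ Bicoloured (induced (v ∷ S)) (lookup f) c
      acyclic {m} c cyc bi@(a , b , ab) with anyᶠ? (λ i → c i ≟ᶠ v)
      ... | no v∉c = good.acyclic c (cycle-restrict (λ i → tail (v∉c ∘ (i ,_)) (cycle-⊆ cyc i)) cyc) bi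
        where
        tail : ∀ {x} → x ≢ v → x ∈ v ∷ S → x ∈ S
        tail x≢v (here x≡v) = contradiction x≡v x≢v
        tail x≢v (there x∈) = x∈
      ... | yes (i , refl)
        with w , chain , perm ← chain-rotate (∈-tabulate⁺ {f = c} i)
               (chain-tabulate (2 + m) c (IsCycle.step cyc) (IsCycle.close cyc))
        with cs ← All-resp-↭ perm (All.tabulate⁺ ab)
        with len ← trans (sym (suc-injective (↭-length perm))) (length-tabulate (c ∘ suc))
        with closed-walk-odd extend-proper w chain cs
      -- A cycle has at least two vertices besides `v`, so a single one is impossible.
      ... | zero  , odd with () ← trans (sym odd) len
      ... | suc j , odd = few (≤-trans
        (two-closedWalks {j = j} h len′ chain cs (Unique-↭ perm (Unique.tabulate⁺ (IsCycle.injective cyc))) h≥1)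
        (∑-≥-term (λ j → ∑ (closedWalks v j) h) (∈-downFrom⁺ j<n)))
        where
        len′ : length w ≡ 3 + 2 * j
        len′ = trans odd (cong suc (*-suc 2 j))
        -- Comparing lengths gives m = 1 + 2j, and `cycle-short` gives m < n; hence summing over
        -- `downFrom n` reaches every cycle length.
        j<n : j < n
        j<n = ≤-<-trans (≤-trans (m≤m+n j _) (≤-trans (n≤1+n _)
          (≤-reflexive (suc-injective (suc-injective (trans (sym len′) len)))))) (cycle-short _ cyc)

-- Counting bad maps, and the induction on the vertex set.

^-distribʳ-* : ∀ j a b → (a * b) ^ j ≡ a ^ j * b ^ j
^-distribʳ-* zero    a b = refl
^-distribʳ-* (suc j) a b = trans (cong (a * b *_) (^-distribʳ-* j a b)) (regroup a b (a ^ j) (b ^ j))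
  where
  regroup : ∀ a b A B → a * b * (A * B) ≡ a * A * (b * B)
  regroup = solve-∀

*-⟦⟧-≤ : ∀ {P : Set} {b} c (p : Dec P) → (P → c ≤ b) → c * ⟦ p ⟧ ≤ b
*-⟦⟧-≤ {b = b} c (yes a) le = subst (_≤ b) (sym (*-identityʳ c)) (le a)
*-⟦⟧-≤ {b = b} c (no _)  le = subst (_≤ b) (sym (*-zeroʳ c)) z≤n

module _ {n} (G : Graph (Fin n)) {γ Δ m : ℕ}
  (deg   : ∀ x → length (neighbours G x) ≤ Δ)
  (codeg : ∀ {x y} → x ≢ y → ¬ (Graph._∼_ G x y) → length (commonNeighbours G x y) ≤ γ)
  (large : (2 * γ + 4) * Δ ^ 2 ≤ m * m) .{{_ : NonZero m}}
  where
  open Graph G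

  k : ℕ
  k = Δ + m

  instance
    k-nonZero : NonZero k
    k-nonZero = >-nonZero (≤-trans (>-nonZero⁻¹ m) (m≤n+m m Δ))

  colourings : List (Vec (Fin k) n)
  colourings = vectors n

  N : List (Fin n) → ℕ
  N = #good G {k}

  conflict : (S : List (Fin n)) (v u : Fin n) → ℕ
  conflict S v u = ∑[ f ← colourings ] ⟦ good? G S f ×-dec (lookup f v ≟ᶠ lookup f u) ⟧

  skipping : (S : List (Fin n)) (w : List (Fin n)) → ℕ
  skipping S w = ∑[ f ← colourings ] ⟦ good? G S f ×-dec skipEqual? (lookup f) w ⟧

  conflict-≤ : ∀ {S v u} → v ∉ S → v ∼ u → k * conflict S v u ≤ N S
  conflict-≤ {S} v∉S v∼u = count-equal (good? G S) (λ v≡u → ∼-irrefl v≡u v∼u)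
    (λ {f} {a} → good-resample G {f = f} {a} v∉S)

  -- The colour of `x` is forced by that of `z`. All other conditions ignore it, as `x` is neither
  -- in `S` nor further along the list.
  skipping-∷ : ∀ {S x y z w} → x ∉ S → Unique (x ∷ y ∷ z ∷ w) →
               k * skipping S (x ∷ y ∷ z ∷ w) ≤ skipping S (y ∷ z ∷ w)
  skipping-∷ {S} {x} {y} {z} {w} x∉S (x∉w@(_ ∷ x≢z ∷ _) ∷ _) = begin
    k * skipping S (x ∷ y ∷ z ∷ w)
      ≤⟨ *-monoʳ-≤ k (∑-mono colourings (λ f → ⟦⟧-mono _
           ((good? G S f ×-dec skipEqual? (lookup f) (y ∷ z ∷ w)) ×-dec (lookup f x ≟ᶠ lookup f z))
           (λ (g , eq , rest) → (g , rest) , eq))) ⟩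
    k * ∑[ f ← colourings ]
      ⟦ (good? G S f ×-dec skipEqual? (lookup f) (y ∷ z ∷ w)) ×-dec (lookup f x ≟ᶠ lookup f z) ⟧
      ≤⟨ count-equal (λ f → good? G S f ×-dec skipEqual? (lookup f) (y ∷ z ∷ w)) x≢z
           (λ {f} {a} (g , rest) → good-resample G {f = f} {a} x∉S g ,
                                   skipEqual-resample G {f = f} {a} (y ∷ z ∷ w) x∉w rest) ⟩
    skipping S (y ∷ z ∷ w) ∎
    where open ≤-Reasoning

  skipping-⊆ : ∀ {S T} w → (∀ {x} → x ∈ S → x ∈ T) → skipping T w ≤ skipping S w
  skipping-⊆ {S} {T} w S⊆T = ∑-mono colourings (λ f → ⟦⟧-mono _
    (good? G S f ×-dec skipEqual? (lookup f) w) (λ (g , rest) → good-⊆ G {f = f} S⊆T g , rest))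

  -- The induction hypothesis: putting a vertex back costs at most a factor 2k/m in the number of
  -- good maps.
  Removable : ℕ → Set
  Removable s = ∀ T → length T ≤ s → ∀ x → m * N (delete x T) ≤ 2 * (k * N T)

  -- All but the last two colours are forced. Forcing one gains a factor 1/k once its vertex is
  -- deleted from `T`, and restoring the vertex costs 2k/m: a net factor 2/m for each of the `j`
  -- forced vertices.
  skipping-≤ : ∀ {s} → Removable s → ∀ j w T → length T ≤ s → Unique w → length w ≡ 2 + j →
               m ^ j * skipping T w ≤ 2 ^ j * N T
  skipping-≤ rem zero w T T≤s unique len = *-monoʳ-≤ 1 (∑-mono colourings (λ f →
    ⟦⟧-mono _ (good? G T f) proj₁))
  skipping-≤ rem (suc j) (x ∷ w@(_ ∷ _ ∷ _)) T T≤s unique@(_ ∷ unique′) len = *-cancelˡ-≤ k (begin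
    k * (m * m ^ j * skipping T (x ∷ w))
      ≤⟨ *-monoʳ-≤ k (*-monoʳ-≤ (m * m ^ j) (skipping-⊆ (x ∷ w) delete-⊆)) ⟩
    k * (m * m ^ j * skipping T⁻ (x ∷ w))
      ≡⟨ regroup₁ k m (m ^ j) _ ⟩
    m * (m ^ j * (k * skipping T⁻ (x ∷ w)))
      ≤⟨ *-monoʳ-≤ m (*-monoʳ-≤ (m ^ j) (skipping-∷ (λ x∈ → proj₂ (∈-delete⁻ {S = T} x∈) refl) unique)) ⟩
    m * (m ^ j * skipping T⁻ w)
      ≤⟨ *-monoʳ-≤ m (skipping-≤ rem j w T⁻ (≤-trans (length-filter _ T) T≤s) unique′ (suc-injective len)) ⟩
    m * (2 ^ j * N T⁻)
      ≡⟨ regroup₂ m (2 ^ j) (N T⁻) ⟩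
    2 ^ j * (m * N T⁻)
      ≤⟨ *-monoʳ-≤ (2 ^ j) (rem T T≤s x) ⟩
    2 ^ j * (2 * (k * N T))
      ≡⟨ regroup₃ (2 ^ j) k (N T) ⟩
    k * (2 * 2 ^ j * N T) ∎)
    where
    open ≤-Reasoning
    T⁻ = delete x T
    regroup₁ : ∀ k m M c → k * (m * M * c) ≡ m * (M * (k * c))
    regroup₁ = solve-∀
    regroup₂ : ∀ m M c → m * (M * c) ≡ M * (m * c)
    regroup₂ = solve-∀
    regroup₃ : ∀ M k c → M * (2 * (k * c)) ≡ k * (2 * M * c)
    regroup₃ = solve-∀

  module _ {S : List (Fin n)} (rem : Removable (length S)) {v : Fin n} (v∉S : v ∉ S) where

    conflicts : ℕ
    conflicts = ∑ (neighbours G v) (conflict S v)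

    cycles : ℕ → ℕ
    cycles j = ∑[ w ← closedWalks G v j ] skipping S (v ∷ w)

    conflicts-≤ : k * conflicts ≤ Δ * N S
    conflicts-≤ = ≤-trans
      (*-∑-bound k (neighbours G v) (λ u∈ → conflict-≤ v∉S (proj₂ (∈-filter⁻ (v ∼?_) {xs = allFin n} u∈))))
      (*-monoˡ-≤ (N S) (deg v))

    -- Since `v` is not in `S`, forcing its colour gains the full 1/k with nothing to restore. The
    -- other 2j + 1 forced vertices gain 2/m each.
    cycle-≤ : ∀ j {w} → w ∈ closedWalks G v j →
              m ^ (1 + 2 * j) * k * skipping S (v ∷ w) ≤ 2 ^ (1 + 2 * j) * N S
    cycle-≤ j {w} w∈ with _ , len , unique ← ∈-filter⁻ _ {xs = walks G v v (2 + 2 * j)} w∈ = step w len unique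
      where
      open ≤-Reasoning
      step : ∀ w → length w ≡ 3 + 2 * j → Unique (v ∷ w) →
             m ^ (1 + 2 * j) * k * skipping S (v ∷ w) ≤ 2 ^ (1 + 2 * j) * N S
      step w@(_ ∷ _ ∷ _) len unique@(_ ∷ unique′) = begin
        m ^ (1 + 2 * j) * k * skipping S (v ∷ w)
          ≡⟨ *-assoc (m ^ (1 + 2 * j)) k _ ⟩
        m ^ (1 + 2 * j) * (k * skipping S (v ∷ w))
          ≤⟨ *-monoʳ-≤ (m ^ (1 + 2 * j)) (skipping-∷ v∉S unique) ⟩
        m ^ (1 + 2 * j) * skipping S w
          ≤⟨ skipping-≤ rem (1 + 2 * j) w S ≤-refl unique′ len ⟩
        2 ^ (1 + 2 * j) * N S ∎

    -- The number of walks times the bound for one walk, arranged as a geometric term with ratio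
    -- (2Δ)²/m² for `geometric-∑`.
    cycles-≤ : ∀ j → m * ((m ^ 2) ^ j * (k * cycles j)) ≤ 2 * γ * Δ ^ 2 * (((2 * Δ) ^ 2) ^ j * N S)
    cycles-≤ j = begin
      m * ((m ^ 2) ^ j * (k * cycles j))
        ≡⟨ cong (λ e → m * (e * (k * cycles j))) (^-*-assoc m 2 j) ⟩
      m * (m ^ (2 * j) * (k * cycles j))
        ≡⟨ regroup₁ m (m ^ (2 * j)) k (cycles j) ⟩
      m ^ (1 + 2 * j) * k * cycles j
        ≤⟨ *-∑-bound (m ^ (1 + 2 * j) * k) (closedWalks G v j) (cycle-≤ j) ⟩
      length (closedWalks G v j) * (2 ^ (1 + 2 * j) * N S)
        ≤⟨ *-monoˡ-≤ _ (≤-trans (length-filter _ (walks G v v (2 + 2 * j)))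
                                (length-walks G v deg codeg v (2 + 2 * j))) ⟩
      Δ ^ (2 + 2 * j) * γ * (2 ^ (1 + 2 * j) * N S)
        ≡⟨ regroup₂ Δ (Δ ^ (2 * j)) γ (2 ^ (2 * j)) (N S) ⟩
      2 * γ * Δ ^ 2 * (2 ^ (2 * j) * Δ ^ (2 * j) * N S)
        ≡⟨ cong (λ e → 2 * γ * Δ ^ 2 * (e * N S)) (^-distribʳ-* (2 * j) 2 Δ) ⟨
      2 * γ * Δ ^ 2 * ((2 * Δ) ^ (2 * j) * N S)
        ≡⟨ cong (λ e → 2 * γ * Δ ^ 2 * (e * N S)) (^-*-assoc (2 * Δ) 2 j) ⟨
      2 * γ * Δ ^ 2 * (((2 * Δ) ^ 2) ^ j * N S) ∎
      where
      open ≤-Reasoning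
      regroup₁ : ∀ m M k c → m * (M * (k * c)) ≡ m * M * k * c
      regroup₁ = solve-∀
      regroup₂ : ∀ Δ D γ W N → Δ * (Δ * D) * γ * (2 * W * N) ≡ 2 * γ * (Δ * (Δ * 1)) * (W * D * N)
      regroup₂ = solve-∀

    all-cycles-≤ : k * ∑ (downFrom n) cycles ≤ m * N S
    all-cycles-≤ = begin
      k * ∑ (downFrom n) cycles  ≡⟨ ∑-*ˡ k cycles (downFrom n) ⟨
      T                          ≤⟨ *-cancelˡ-≤ ((m ^ 2) ^ n) {{m^n≢0 (m ^ 2) n {{m^n≢0 m 2}}}} (*-cancelˡ-≤ m scaled) ⟩
      m * N S                    ∎
      where
      open ≤-Reasoning
      T = ∑[ j ← downFrom n ] (k * cycles j)
      -- The origin of 2γ + 4: the 4 comes from the ratio of the series, the 2γ from its leading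
      -- coefficient.
      p+e≤q : (2 * Δ) ^ 2 + 2 * γ * Δ ^ 2 ≤ m ^ 2
      p+e≤q = begin
        (2 * Δ) ^ 2 + 2 * γ * Δ ^ 2  ≡⟨ regroup γ Δ ⟩
        (2 * γ + 4) * Δ ^ 2          ≤⟨ large ⟩
        m * m                        ≡⟨ cong (m *_) (*-identityʳ m) ⟨
        m ^ 2                        ∎
        where
        regroup : ∀ γ Δ → 2 * Δ * (2 * Δ * 1) + 2 * γ * (Δ * (Δ * 1)) ≡ (2 * γ + 4) * (Δ * (Δ * 1))
        regroup = solve-∀
      scaled : m * ((m ^ 2) ^ n * T) ≤ m * ((m ^ 2) ^ n * (m * N S))
      scaled = begin
        m * ((m ^ 2) ^ n * T)
          ≤⟨ m≤m+n _ _ ⟩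
        m * ((m ^ 2) ^ n * T) + m ^ 2 * (((2 * Δ) ^ 2) ^ n * N S)
          ≤⟨ geometric-∑ m (N S) (λ j → k * cycles j) p+e≤q cycles-≤ n ⟩
        m ^ 2 * ((m ^ 2) ^ n * N S)
          ≡⟨ regroup m ((m ^ 2) ^ n) (N S) ⟩
        m * ((m ^ 2) ^ n * (m * N S)) ∎
        where
        regroup : ∀ m Q N → m * (m * 1) * (Q * N) ≡ m * (Q * (m * N))
        regroup = solve-∀

    -- A bicoloured cycle through v is found once in each direction: hence the factors 2 on the
    -- other terms.
    good-or-bad : ∀ (f : Vec (Fin k) n) → 2 * ⟦ good? G S f ⟧ ≤ 2 * ⟦ good? G (v ∷ S) f ⟧ +
      (2 * ∑[ u ← neighbours G v ] ⟦ good? G S f ×-dec (lookup f v ≟ᶠ lookup f u) ⟧ +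
       ∑[ j ← downFrom n ] ∑[ w ← closedWalks G v j ] ⟦ good? G S f ×-dec skipEqual? (lookup f) (v ∷ w) ⟧)
    good-or-bad f = *-⟦⟧-≤ 2 (good? G S f) λ good →
      cases good (any? (λ u → lookup f v ≟ᶠ lookup f u) (neighbours G v)) (2 ≤? _)
      where
      a = ⟦ good? G (v ∷ S) f ⟧
      hᵤ = λ u → ⟦ good? G S f ×-dec (lookup f v ≟ᶠ lookup f u) ⟧
      h = λ w → ⟦ good? G S f ×-dec skipEqual? (lookup f) (v ∷ w) ⟧
      b = ∑ (neighbours G v) hᵤ
      c = ∑[ j ← downFrom n ] ∑ (closedWalks G v j) h
      cases : Good G S f → Dec (Any (λ u → lookup f v ≡ lookup f u) (neighbours G v)) →
              Dec (2 ≤ c) → 2 ≤ 2 * a + (2 * b + c)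
      cases good (yes clash) _ with u , u∈ , eq ← find clash =
        m≤n⇒m≤o+n (2 * a) (m≤n⇒m≤n+o c (*-monoʳ-≤ 2 (≤-trans (⟦⟧≥1 _ (good , eq)) (∑-≥-term hᵤ u∈))))
      cases good (no _) (yes 2≤c) = m≤n⇒m≤o+n (2 * a) (m≤n⇒m≤o+n (2 * b) 2≤c)
      cases good (no rainbow) (no few) = m≤n⇒m≤n+o _ (*-monoʳ-≤ 2 (⟦⟧≥1 (good? G (v ∷ S) f)
        (good-extend G {f = f} good (λ v∼u eq → rainbow (Any.map (λ { refl → eq }) (∈-neighbours G v∼u)))
          h (λ skip → ⟦⟧≥1 _ (good , skip)) few)))

    double-count : 2 * N S ≤ 2 * N (v ∷ S) + (2 * conflicts + ∑ (downFrom n) cycles)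
    double-count = begin
      2 * N S
        ≡⟨ ∑-*ˡ 2 _ colourings ⟨
      ∑[ f ← colourings ] (2 * ⟦ good? G S f ⟧)
        ≤⟨ ∑-mono colourings good-or-bad ⟩
      ∑[ f ← colourings ] (2 * extended f + (2 * clashing f + cyclic f))
        ≡⟨ ∑-+ (λ f → 2 * extended f) _ colourings ⟩
      ∑[ f ← colourings ] (2 * extended f) + ∑[ f ← colourings ] (2 * clashing f + cyclic f)
        ≡⟨ cong₂ _+_ (∑-*ˡ 2 extended colourings) (trans (∑-+ (λ f → 2 * clashing f) cyclic colourings)
             (cong₂ _+_ (trans (∑-*ˡ 2 clashing colourings) (cong (2 *_) (∑-swap _ colourings (neighbours G v))))
               (trans (∑-swap _ colourings (downFrom n))
                 (∑-cong (downFrom n) (λ j → ∑-swap _ colourings (closedWalks G v j)))))) ⟩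
      2 * N (v ∷ S) + (2 * conflicts + ∑ (downFrom n) cycles) ∎
      where
      open ≤-Reasoning
      extended clashing cyclic : Vec (Fin k) n → ℕ
      extended f = ⟦ good? G (v ∷ S) f ⟧
      clashing f = ∑[ u ← neighbours G v ] ⟦ good? G S f ×-dec (lookup f v ≟ᶠ lookup f u) ⟧
      cyclic f = ∑[ j ← downFrom n ] ∑[ w ← closedWalks G v j ] ⟦ good? G S f ×-dec skipEqual? (lookup f) (v ∷ w) ⟧

    -- Split 2k as m + 2Δ + m. Of 2k `N S`, colour clashes account for at most 2Δ `N S` and
    -- bicoloured cycles for at most m `N S`; the remaining m `N S` must come from maps good on
    -- `v ∷ S`.
    extend-≤ : m * N S ≤ 2 * (k * N (v ∷ S))
    extend-≤ = +-cancelʳ-≤ (2 * (Δ * N S) + m * N S) _ _ (begin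
      m * N S + (2 * (Δ * N S) + m * N S)
        ≡⟨ regroup₁ m Δ (N S) ⟩
      k * (2 * N S)
        ≤⟨ *-monoʳ-≤ k double-count ⟩
      k * (2 * N (v ∷ S) + (2 * conflicts + ∑ (downFrom n) cycles))
        ≡⟨ regroup₂ k (N (v ∷ S)) conflicts _ ⟩
      2 * (k * N (v ∷ S)) + (2 * (k * conflicts) + k * ∑ (downFrom n) cycles)
        ≤⟨ +-monoʳ-≤ (2 * (k * N (v ∷ S))) (+-mono-≤ (*-monoʳ-≤ 2 conflicts-≤) all-cycles-≤) ⟩
      2 * (k * N (v ∷ S)) + (2 * (Δ * N S) + m * N S) ∎)
      where
      open ≤-Reasoning
      regroup₁ : ∀ m Δ N → m * N + (2 * (Δ * N) + m * N) ≡ (Δ + m) * (2 * N)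
      regroup₁ = solve-∀
      regroup₂ : ∀ k a b c → k * (2 * a + (2 * b + c)) ≡ 2 * (k * a) + (2 * (k * b) + k * c)
      regroup₂ = solve-∀

  m*≤2*k* : ∀ {a b} → a ≤ b → m * a ≤ 2 * (k * b)
  m*≤2*k* {a} {b} a≤b = ≤-trans (*-mono-≤ (m≤n+m m Δ) a≤b) (m≤m+n (k * b) _)

  -- Induction on size: if `x` is in `T`, then `delete x T` is shorter, so `extend-≤` applies to it
  -- and adding `x` recovers `T` as a set. If `x` is absent, deletion loses nothing and m ≤ 2k
  -- suffices.
  removable : ∀ s → Removable s
  removable s T T≤s x with x ∈? T
  ... | no x∉T = m*≤2*k* (#good-⊆ G {k} (λ {y} y∈ → ∈-delete⁺ y∈ (λ { refl → x∉T y∈ })))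
  removable zero    (_ ∷ _) () x | yes _
  removable (suc s) T T≤s x      | yes x∈T = ≤-trans
    (extend-≤ (λ U U≤ → removable s U (≤-trans U≤ (≤-pred (≤-trans (length-delete x∈T) T≤s))))
      (λ x∈ → proj₂ (∈-delete⁻ {S = T} x∈) refl))
    (*-monoʳ-≤ 2 (*-monoʳ-≤ k (#good-⊆ G {k} ∷-delete-⊇)))

  #good>0 : ∀ S → 0 < N S
  #good>0 [] = ≤-trans (⟦⟧≥1 (good? G [] f) trivial) (∑-≥-term (λ f → ⟦ good? G [] f ⟧) (∈-vectors f))
    where
    f : Vec (Fin k) n
    f = replicate n (fromℕ< (>-nonZero⁻¹ k))
    trivial : Good G [] f
    trivial = record { proper = λ { (_ , () , _) } ; acyclic = λ c cyc _ → case cycle-⊆ G cyc zero of λ () }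
  #good>0 (v ∷ S) with v ∈? S
  -- The list may repeat a vertex, in which case the vertex set does not grow.
  ... | yes v∈S = ≤-trans (#good>0 S) (#good-⊆ G {k} λ { (here refl) → v∈S ; (there x∈) → x∈ })
  ... | no  v∉S = n≢0⇒n>0 λ N≡0 → <⇒≱ (*-mono-< (>-nonZero⁻¹ m) (#good>0 S)) (begin
    m * N S              ≤⟨ extend-≤ (removable (length S)) v∉S ⟩
    2 * (k * N (v ∷ S))  ≡⟨ cong (λ e → 2 * (k * e)) N≡0 ⟩
    2 * (k * 0)          ≡⟨ cong (2 *_) (*-zeroʳ k) ⟩
    0                    ∎)
    where open ≤-Reasoning

  colourable : AcyclicallyColourable G k
  colourable = let f , pos = ∑>0 _ colourings (#good>0 (allFin n))
                   good    = ⟦⟧>0 (good? G (allFin n) f) pos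
                   open IsAcyclicColouring good
    in lookup f , record
    { proper  = λ {x} {y} x∼y → proper (x∼y , ∈-allFin x , ∈-allFin y)
    ; acyclic = λ c cyc → acyclic c (record
        { injective = IsCycle.injective cyc
        ; step      = λ i → IsCycle.step cyc i , ∈-allFin _ , ∈-allFin _
        ; close     = IsCycle.close cyc , ∈-allFin _ , ∈-allFin _
        })
    }

-- The bound for the acyclic chromatic number.

theorem2 : ∀ (γ : ℕ) → 1 ≤ γ →
    ∀ (n : ℕ) (G : Graph (Fin n)) (Δ : ℕ) → maxDegree G ≡ Δ → 1 ≤ Δ →
    ¬ (∃ λ (c : Copy (K 2 (suc γ)) G) → NonAdjacentPair G c) →
    χₐ G ≤ ⌈[1+√ 2 * γ + 4 ]* Δ ⌉
theorem2 γ _ n G Δ refl 1≤Δ noCopy = proj₂ (proj₂ (χₐ-least G))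
  (colourable G {γ} {Δ} {m} (degree≤maxDegree G)
    (λ {x} {y} x≢y x≁y → ≮⇒≥ (noCopy ∘ commonNeighbours-copy G x≢y x≁y))
    large {{m≢0 m large}})
  where
  D = (2 * γ + 4) * Δ ^ 2
  m = ⌈√ D ⌉
  large : D ≤ m * m
  large = proj₁ (proj₂ (⌈√⌉-least D))
  -- As Δ is at least 1, `D` is positive and its rounded-up root cannot be 0.
  m≢0 : ∀ m → D ≤ m * m → NonZero m
  m≢0 zero    D≤0 = contradiction D≤0 (<⇒≱ (*-mono-< {0} {2 * γ + 4} {0} {Δ ^ 2}
    (≤-trans (s≤s z≤n) (m≤n+m 4 (2 * γ))) (>-nonZero⁻¹ (Δ ^ 2) {{m^n≢0 Δ 2 {{>-nonZero 1≤Δ}}}})))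
  m≢0 (suc m) _   = _
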